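{- Let $G$ be a connected partial cube with $\Theta$-classes $E_1,\ldots,E_d$. For each $k$ let $U_k$ and $U_k'$ be the two connected components of $G-E_k$, and for $k,l\in\{1,\ldots,d\}$ set $m_{kl}^{11}=|E(U_k)\cap E(U_l)|$, $m_{kl}^{10}=|E(U_k)\cap E(U_l')|$, $m_{kl}^{01}=|E(U_k')\cap E(U_l)|$, $m_{kl}^{00}=|E(U_k')\cap E(U_l')|$. Then $$WW_e(G)=2W_e(G)+\sum_{k=1}^{d-1}\sum_{l=k+1}^{d}\big(m_{kl}^{11}m_{kl}^{00}+m_{kl}^{10}m_{kl}^{01}\big)-\binom{|E(G)|}{2}.$$
   Context: A partial cube is a graph isomorphic to an isometric subgraph of a hypercube. The Djoković–Winkler relation $\Theta$ on $E(G)$: $xy\,\Theta\,uv$ iff $d(x,u)+d(y,v)\neq d(x,v)+d(y,u)$, with $d$ the shortest-path distance. In a partial cube $\Theta$ is an equivalence relation whose classes are the $\Theta$-classes, and removing a $\Theta$-class leaves exactly two connected components. The distance $d(e,f)$ between edges is the distance between $e$ and $f$ as vertices of the line graph $L(G)$. The edge-Wiener index is $W_e(G)=\sum_{\{e,f\}\subseteq E(G)}d(e,f)$ and the edge-hyper-Wiener index is $WW_e(G)=\frac12\sum_{\{e,f\}\subseteq E(G)}d(e,f)+\frac12\sum_{\{e,f\}\subseteq E(G)}d(e,f)^2$, sums over unordered pairs of distinct edges. -}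

module Defs where

open import Data.Bool.Base using (Bool; if_then_else_)
open import Data.Bool.Properties using () renaming (_≟_ to _≟ᵇ_)
open import Data.Fin.Base using (Fin; zero; suc; toℕ)
open import Data.Fin.Properties using (_≟_; _<?_; any?; all?; pigeonhole; toℕ<n)
open import Data.Fin.Subset using (Subset; _∈_)
open import Data.Fin.Subset.Properties using (_∈?_)
open import Data.Integer.Base using (+_)
open import Data.List.Base as List using (List; allFin; cartesianProduct; filter; length)
open import Data.Nat.Base using (ℕ; zero; suc; _+_; _^_; _∸_; _≤_; _<_; z≤n; s≤s; s≤s⁻¹)
open import Data.Nat.Induction using (<-rec)
open import Data.Nat.Properties
  using (+-0-commutativeMonoid; ≮⇒≥; +-monoˡ-<; m+[n∸m]≡n; module ≤-Reasoning)
  renaming (_<?_ to _<ⁿ?_)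
open import Data.Product.Base using (_×_; _,_; proj₁; proj₂; ∃; Σ)
open import Data.Product.Properties using (≡-dec)
open import Data.Rational.Base as ℚ using (ℚ; ½; _/_)
open import Data.Refinement.Base using (Refinement; value)
open import Data.Sum.Base as Sum using (_⊎_)
open import Data.Vec.Base using (Vec; lookup; tabulate)
open import Function.Base using (_∘_; _on_)
open import Function.Bundles using (_⇔_; _↔_; Inverse)
open import Function.Definitions using (Injective)
open import Level using (0ℓ)
open import Relation.Binary.Core using (Rel)
open import Relation.Binary.Definitions using (Decidable; Symmetric)
open import Relation.Binary.PropositionalEquality using (_≡_; _≢_; refl; sym; subst)
open import Relation.Nullary.Decidable
  using (Dec; yes; no; does; map′; ¬?; _×-dec_; _⊎-dec_; _→-dec_)
open import Relation.Nullary.Negation using (¬_; contradiction)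
open import Relation.Unary using (Pred)
import Relation.Unary as U

open import Algebra.Properties.CommutativeMonoid.Sum +-0-commutativeMonoid public
  using (sum; sum-syntax)

private
  variable
    V W : Set
    n k l : ℕ

record Graph (V : Set) : Set₁ where
  infix 4 _~_ _~?_
  field
    _~_      : Rel V 0ℓ
    _~?_     : Decidable _~_
    ~-sym    : Symmetric _~_
    ~-irrefl : ∀ {v} → ¬ (v ~ v)

data Walk (G : Graph V) : V → V → ℕ → Set where
  []  : ∀ {u} → Walk G u u 0
  _∷_ : ∀ {u v w} → Graph._~_ G u v → Walk G v w k → Walk G u w (suc k)

Connected : Graph V → Set
Connected G = ∀ u v → ∃ (Walk G u v)

IsDistance : Graph V → V → V → ℕ → Set
IsDistance G u v k = Walk G u v k × (∀ {l} → Walk G u v l → k ≤ l)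

record _≅_ (G : Graph V) (H : Graph W) : Set where
  private
    module G = Graph G
    module H = Graph H
  field
    bijection : V ↔ W
    adjacency : ∀ {u v} → u G.~ v ⇔ Inverse.to bijection u H.~ Inverse.to bijection v

record Subgraph (G : Graph V) : Set₁ where
  open Graph G
  field
    vertex   : Pred V 0ℓ
    edge     : Rel V 0ℓ
    edge?    : Decidable edge
    edge-sym : Symmetric edge
    edge⇒~   : ∀ {u v} → edge u v → u ~ v
    edge⇒vtx : ∀ {u v} → edge u v → vertex u × vertex v

  VertexOf : Set
  VertexOf = Refinement V vertex

  asGraph : Graph VertexOf
  asGraph = record
    { _~_      = edge on value
    ; _~?_     = λ u v → edge? (value u) (value v)
    ; ~-sym    = edge-sym
    ; ~-irrefl = ~-irrefl ∘ edge⇒~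
    }

  Isometric : Set
  Isometric = ∀ (u v : VertexOf) k → IsDistance asGraph u v k ⇔ IsDistance G (value u) (value v) k

Hypercube : ∀ D → Graph (Vec Bool D)
Hypercube D = record
  { _~_      = λ x y → ∃ λ i → lookup x i ≢ lookup y i × (∀ j → j ≢ i → lookup x j ≡ lookup y j)
  ; _~?_     = λ x y → any? λ i → ¬? (lookup x i ≟ᵇ lookup y i)
                 ×-dec all? λ j → ¬? (j ≟ i) →-dec (lookup x j ≟ᵇ lookup y j)
  ; ~-sym    = λ (i , x≢y , x≡y) → i , x≢y ∘ sym , λ j j≢i → sym (x≡y j j≢i)
  ; ~-irrefl = λ (i , x≢x , _) → x≢x refl
  }

IsPartialCube : Graph V → Set₁
IsPartialCube G = ∃ λ D → Σ (Subgraph (Hypercube D)) λ H → Subgraph.Isometric H × G ≅ Subgraph.asGraph H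

walk? : (G : Graph (Fin n)) → ∀ u v k → Dec (Walk G u v k)
walk? G u v zero = map′ (λ { refl → [] }) (λ { [] → refl }) (u ≟ v)
walk? G u v (suc k) = map′ (λ (_ , e , p) → e ∷ p) (λ { (e ∷ p) → _ , e , p })
  (any? λ w → Graph._~?_ G u w ×-dec walk? G w v k)

-- The least number below the bound satisfying the predicate, or the bound
-- itself if there is none.
least : {P : Pred ℕ 0ℓ} → U.Decidable P → ℕ → ℕ
least P? zero    = zero
least P? (suc b) = if does (P? zero) then zero else suc (least (P? ∘ suc) b)

-- A shortest walk in a graph with n vertices has length below n, so the search
-- finds the distance whenever u and v are joined by a walk (dist-isDistance);
-- otherwise the value is n.
dist : Graph (Fin n) → Fin n → Fin n → ℕ
dist {n} G u v = least (walk? G u v) n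

least-≤ : {P : Pred ℕ 0ℓ} (P? : U.Decidable P) → ∀ b → P k → least P? b ≤ k
least-≤ P? zero    p = z≤n
least-≤ P? (suc b) p with P? zero
... | yes _ = z≤n
least-≤ {zero}  P? (suc b) p | no ¬p = contradiction p ¬p
least-≤ {suc k} P? (suc b) p | no _  = s≤s (least-≤ (P? ∘ suc) b p)

least-holds : {P : Pred ℕ 0ℓ} (P? : U.Decidable P) → ∀ b → k < b → P k → P (least P? b)
least-holds P? (suc b) k<b p with P? zero
... | yes p₀ = p₀
least-holds {zero}  P? (suc b) k<b p | no ¬p = contradiction p ¬p
least-holds {suc k} P? (suc b) k<b p | no _  = least-holds (P? ∘ suc) b (s≤s⁻¹ k<b) p

module _ {G : Graph V} where

  _++_ : ∀ {u v w} → Walk G u v k → Walk G v w l → Walk G u w (k + l)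
  []      ++ q = q
  (e ∷ p) ++ q = e ∷ (p ++ q)

  vertexAt : ∀ {u v} → Walk G u v k → Fin (suc k) → V
  vertexAt {u = u} p zero    = u
  vertexAt (e ∷ p) (suc i) = vertexAt p i

  upTo : ∀ {u v} (p : Walk G u v k) i → Walk G u (vertexAt p i) (toℕ i)
  upTo p       zero    = []
  upTo (e ∷ p) (suc i) = e ∷ upTo p i

  onFrom : ∀ {u v} (p : Walk G u v k) i → Walk G (vertexAt p i) v (k ∸ toℕ i)
  onFrom p       zero    = p
  onFrom (e ∷ p) (suc i) = onFrom p i

shorten : {G : Graph (Fin n)} → ∀ {u v} → n ≤ k → Walk G u v k → ∃ λ l → l < k × Walk G u v l
shorten {k = k} {G = G} {v = v} n≤k p with pigeonhole (s≤s n≤k) (vertexAt p)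
... | i , j , i<j , eq =
  toℕ i + (k ∸ toℕ j) , shorter , (upTo p i ++ subst (λ x → Walk G x v _) (sym eq) (onFrom p j))
  where
  open ≤-Reasoning
  shorter : toℕ i + (k ∸ toℕ j) < k
  shorter = begin-strict
    toℕ i + (k ∸ toℕ j) <⟨ +-monoˡ-< (k ∸ toℕ j) i<j ⟩
    toℕ j + (k ∸ toℕ j) ≡⟨ m+[n∸m]≡n (s≤s⁻¹ (toℕ<n j)) ⟩
    k                   ∎

short : {G : Graph (Fin n)} → ∀ {u v} → Walk G u v k → ∃ λ l → l < n × Walk G u v l
short {n = n} {G = G} {u} {v} = <-rec (λ k → Walk G u v k → ∃ λ l → l < n × Walk G u v l) step _
  where
  step : ∀ k → (∀ {l} → l < k → Walk G u v l → ∃ λ l → l < n × Walk G u v l) →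
         Walk G u v k → ∃ λ l → l < n × Walk G u v l
  step k rec p with k <ⁿ? n
  ... | yes k<n = k , k<n , p
  ... | no  k≮n = let _ , l<k , q = shorten (≮⇒≥ k≮n) p in rec l<k q

dist-isDistance : (G : Graph (Fin n)) → ∀ {u v} → Walk G u v k → IsDistance G u v (dist G u v)
dist-isDistance {n = n} G {u} {v} p =
  let _ , l<n , q = short p in
  least-holds (walk? G u v) n l<n q , least-≤ (walk? G u v) n

-- Summing over i < j runs through the unordered pairs of distinct elements once each.
pairSum : ∀ n → (Fin n → Fin n → ℕ) → ℕ
pairSum n f = ∑[ i < n ] ∑[ j < n ] (if does (i <? j) then f i j else 0)

module _ (G : Graph (Fin n)) where
  open Graph G

  -- Each edge appears once, as the pair (u , v) of its ends with u < v.
  edges : List (Fin n × Fin n)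
  edges = filter (λ (u , v) → (u <? v) ×-dec (u ~? v)) (cartesianProduct (allFin n) (allFin n))

  size : ℕ
  size = length edges

  Edge : Set
  Edge = Fin size

  EdgeSet : Set
  EdgeSet = Subset size

  ends : Edge → Fin n × Fin n
  ends = List.lookup edges

  _endOf_ : Fin n → Edge → Set
  v endOf e = v ≡ proj₁ (ends e) ⊎ v ≡ proj₂ (ends e)

  _endOf?_ : ∀ v e → Dec (v endOf e)
  v endOf? e = (v ≟ proj₁ (ends e)) ⊎-dec (v ≟ proj₂ (ends e))

  Joins : Fin n → Fin n → Edge → Set
  Joins u v e = ends e ≡ (u , v) ⊎ ends e ≡ (v , u)

  joins? : ∀ u v e → Dec (Joins u v e)
  joins? u v e = ≡-dec _≟_ _≟_ (ends e) (u , v) ⊎-dec ≡-dec _≟_ _≟_ (ends e) (v , u)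

  LineGraph : Graph Edge
  LineGraph = record
    { _~_      = λ e f → e ≢ f × ∃ λ v → v endOf e × v endOf f
    ; _~?_     = λ e f → ¬? (e ≟ f) ×-dec any? λ v → (v endOf? e) ×-dec (v endOf? f)
    ; ~-sym    = λ (e≢f , v , ve , vf) → e≢f ∘ sym , v , vf , ve
    ; ~-irrefl = λ (e≢e , _) → e≢e refl
    }

  edgeDist : Edge → Edge → ℕ
  edgeDist = dist LineGraph

  edgeWiener : ℕ
  edgeWiener = pairSum size edgeDist

  edgeHyperWiener : ℚ
  edgeHyperWiener = ½ ℚ.* (+ pairSum size edgeDist / 1)
              ℚ.+ ½ ℚ.* (+ pairSum size (λ e f → edgeDist e f ^ 2) / 1)

  Θ : Rel Edge 0ℓ
  Θ e f = let x , y = ends e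
              u , v = ends f
          in dist G x u + dist G y v ≢ dist G x v + dist G y u

  IsClassOf : Edge → EdgeSet → Set
  IsClassOf e C = ∀ f → f ∈ C ⇔ Θ e f

  record AreΘClasses {d} (E : Fin d → EdgeSet) : Set where
    field
      isClass  : ∀ k → ∃ λ e → IsClassOf e (E k)
      distinct : Injective _≡_ _≡_ E
      complete : ∀ e → ∃ λ k → IsClassOf e (E k)

  -- The edges of the subgraph of G ─ F induced on U.
  edgesWithin : EdgeSet → Subset n → EdgeSet
  edgesWithin F U = tabulate λ e →
    does (¬? (e ∈? F) ×-dec (proj₁ (ends e) ∈? U) ×-dec (proj₂ (ends e) ∈? U))

infixl 6 _─_
_─_ : (G : Graph (Fin n)) → EdgeSet G → Graph (Fin n)
_─_ {n} G F = record
  { _~_      = λ u v → u ~ v × ¬ Deleted u v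
  ; _~?_     = λ u v → (u ~? v) ×-dec ¬? (any? λ e → (e ∈? F) ×-dec joins? G u v e)
  ; ~-sym    = λ (u~v , kept) → ~-sym u~v , λ (e , e∈F , j) → kept (e , e∈F , Sum.swap j)
  ; ~-irrefl = λ (v~v , _) → ~-irrefl v~v
  }
  where
  open Graph G
  Deleted : Rel (Fin n) 0ℓ
  Deleted u v = ∃ λ e → e ∈ F × Joins G u v e

IsComponent : Graph (Fin n) → Subset n → Set
IsComponent G U = ∃ λ v → ∀ w → w ∈ U ⇔ ∃ (Walk G v w)

record AreTheTwoComponents (G : Graph (Fin n)) (U U′ : Subset n) : Set where
  field
    isComponent  : IsComponent G U
    isComponent′ : IsComponent G U′
    distinct     : U ≢ U′
    exhaustive   : ∀ v → v ∈ U ⊎ v ∈ U′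

{-# OPTIONS --safe #-}
-- Embed G isometrically into a hypercube; the Θ-classes are the sets of edges of a given
-- direction, and the two components of G ─ E_k are the two values of the corresponding
-- coordinate.  For distinct edges e and f, d(e , f) = 1 + δ(e , f), where δ(e , f) counts the
-- classes k that separate e from f (one lies in U_k, the other in U_k′): a line-graph step
-- through g can only undo the separation by the class of g, and conversely e and f have ends
-- at distance at most δ(e , f).  Writing P(e , f) for the number of pairs k < l of separating
-- classes, δ² = δ + 2P gives ½ d + ½ d² = 2 d + P − 1.  Summed over all pairs of edges, P is
-- counted class pair by class pair, which yields the products of the m_kl.
module Submission where

open import Defs
open import Data.Bool.Base using (Bool; true; false; not; _∧_; _xor_)
open import Data.Bool.Properties using (xor-same; ∧-idem; not-involutive) renaming (_≟_ to _≟ᵇ_)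
open import Data.Fin.Base using (Fin; zero; suc; punchIn; _<_)
open import Data.Fin.Properties using (_≟_; _<?_; <-cmp; punchInᵢ≢i)
open import Data.Fin.Subset using (Subset; ∣_∣; _∩_; _∈_)
open import Data.Fin.Subset.Properties using (_∈?_; ⊆-antisym)
open import Data.Integer.Base using (+_)
import Data.Integer.Base as ℤ
import Data.Integer.Properties as ℤ
open import Data.List.Base using (List; allFin; cartesianProduct)
open import Data.List.Membership.Propositional.Properties
  using (∈-filter⁺; ∈-filter⁻; ∈-cartesianProduct⁺; ∈-allFin; ∈-lookup)
open import Data.List.Relation.Unary.Any using (index)
open import Data.List.Relation.Unary.Any.Properties using (lookup-index)
open import Data.Nat.Base using (ℕ; zero; suc; _+_; _*_; _^_; _≤_; z≤n; s≤s; s≤s⁻¹)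
open import Data.Nat.Combinatorics using (_C_; nC1≡n; nCk+nC[k+1]≡[n+1]C[k+1])
open import Data.Nat.Properties hiding (_≟_; _<?_; <-cmp)
open import Data.Nat.Solver using (module +-*-Solver)
open import Data.Product.Base using (_×_; _,_; proj₁; proj₂; ∃)
open import Data.Rational.Base as ℚ using (½; _/_; toℚᵘ)
import Data.Rational.Properties as ℚ
import Data.Rational.Solver as ℚ-Solver
open import Data.Rational.Unnormalised.Base as ℚᵘ using (mkℚᵘ; *≡*)
import Data.Rational.Unnormalised.Properties as ℚᵘ
open import Data.Refinement.Base using (value)
open import Data.Sum.Base using (inj₁; inj₂)
open import Data.Vec.Base using (Vec; []; _∷_; lookup)
open import Data.Vec.Functional using (removeAt)
open import Data.Vec.Properties using (lookup-zipWith; lookup∘tabulate; []=⇒lookup; lookup⇒[]=)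
open import Function.Base using (_∘_; _$_)
open import Function.Bundles using (_⇔_; mk⇔; Inverse; Equivalence)
open import Relation.Binary.Definitions using (tri<; tri≈; tri>)
open import Relation.Binary.PropositionalEquality
import Relation.Binary.Reasoning.Setoid as SetoidReasoning
open import Relation.Nullary.Decidable
  using (Dec; yes; no; does; dec-true; dec-false; decidable-stable; _×-dec_)
open import Relation.Nullary.Negation using (¬_; contradiction)
open import Algebra.Properties.CommutativeMonoid.Sum +-0-commutativeMonoid
  using (sum-cong-≗; ∑-distrib-+; sum-remove; sum-replicate-zero)
open import Algebra.Properties.CommutativeSemigroup +-commutativeSemigroup using (interchange)
open import Algebra.Properties.Semiring.Sum +-*-semiring using (*-distribˡ-sum)

private
  variable
    k n d D : ℕ

-- Sums over pairs

sum-mono : {f g : Fin n → ℕ} → (∀ i → f i ≤ g i) → sum f ≤ sum g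
sum-mono {zero}  f≤g = z≤n
sum-mono {suc n} f≤g = +-mono-≤ (f≤g zero) (sum-mono (f≤g ∘ suc))

-- For steps that change a single index: the summand at `i` is split off, and `g i`, being
-- nonnegative, is added back for free.
sum-≤-except : ∀ {f g : Fin n → ℕ} i → (∀ j → j ≢ i → f j ≤ g j) → sum f ≤ f i + sum g
sum-≤-except {suc n} {f} {g} i f≤g = begin
  sum f                          ≡⟨ sum-remove f ⟩
  f i + sum (removeAt f i)       ≤⟨ +-monoʳ-≤ (f i) (sum-mono λ j → f≤g (punchIn i j) (punchInᵢ≢i i j)) ⟩
  f i + sum (removeAt g i)       ≤⟨ +-monoʳ-≤ (f i) (m≤n+m _ (g i)) ⟩
  f i + (g i + sum (removeAt g i)) ≡⟨ cong (_+_ (f i)) (sum-remove g) ⟨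
  f i + sum g                    ∎
  where open ≤-Reasoning

-- Both sums share the remainder once index `i` is removed; stated additively to avoid truncated
-- subtraction.
sum-≡-except : ∀ {f g : Fin n → ℕ} i → (∀ j → j ≢ i → f j ≡ g j) → sum f + g i ≡ sum g + f i
sum-≡-except {suc n} {f} {g} i f≡g = begin
  sum f + g i                      ≡⟨ cong (_+ g i) (sum-remove f) ⟩
  f i + sum (removeAt f i) + g i   ≡⟨ cong (λ s → f i + s + g i) (sum-cong-≗ λ j → f≡g (punchIn i j) (punchInᵢ≢i i j)) ⟩
  f i + sum (removeAt g i) + g i   ≡⟨ solve 3 (λ x y z → x :+ y :+ z := z :+ y :+ x) refl (f i) _ (g i) ⟩
  g i + sum (removeAt g i) + f i   ≡⟨ cong (_+ f i) (sum-remove g) ⟨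
  sum g + f i                      ∎
  where
  open ≡-Reasoning
  open +-*-Solver

sum-one : ∀ n → sum {n} (λ _ → 1) ≡ n
sum-one zero    = refl
sum-one (suc n) = cong suc (sum-one n)

-- `pairSum (suc n) f` computes to the row of `zero` against all successors plus the pair sum over
-- the successors, the shape behind the inductions below. The restriction to `i ≢ j` matters because
-- the formula for `edgeDist` fails on the diagonal.
pairSum-cong : ∀ n {f g : Fin n → Fin n → ℕ} → (∀ i j → i ≢ j → f i j ≡ g i j) → pairSum n f ≡ pairSum n g
pairSum-cong zero    f≡g = refl
pairSum-cong (suc n) f≡g = cong₂ _+_
  (sum-cong-≗ λ j → f≡g zero (suc j) λ ())
  (pairSum-cong n λ i j i≢j → f≡g (suc i) (suc j) λ { refl → i≢j refl })

pairSum-zero : ∀ n → pairSum n (λ _ _ → 0) ≡ 0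
pairSum-zero zero    = refl
pairSum-zero (suc n) = cong₂ _+_ (sum-replicate-zero n) (pairSum-zero n)

pairSum-one : ∀ n → pairSum n (λ _ _ → 1) ≡ n C 2
pairSum-one zero    = refl
pairSum-one (suc n) = begin
  sum {n} (λ _ → 1) + pairSum n (λ _ _ → 1) ≡⟨ cong₂ _+_ (trans (sum-one n) (sym (nC1≡n n))) (pairSum-one n) ⟩
  n C 1 + n C 2                         ≡⟨ nCk+nC[k+1]≡[n+1]C[k+1] n 1 ⟩
  suc n C 2                             ∎
  where open ≡-Reasoning

pairSum-+ : ∀ n (f g : Fin n → Fin n → ℕ) →
            pairSum n (λ i j → f i j + g i j) ≡ pairSum n f + pairSum n g
pairSum-+ zero    f g = refl
pairSum-+ (suc n) f g = trans
  (cong₂ _+_ (∑-distrib-+ (f zero ∘ suc) (g zero ∘ suc)) (pairSum-+ n (λ i → f (suc i) ∘ suc) (λ i → g (suc i) ∘ suc)))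
  (interchange (sum (f zero ∘ suc)) (sum (g zero ∘ suc))
    (pairSum n (λ i → f (suc i) ∘ suc)) (pairSum n (λ i → g (suc i) ∘ suc)))

sum-pairSum-comm : ∀ m n (F : Fin m → Fin n → Fin n → ℕ) →
                   sum (λ i → pairSum n (F i)) ≡ pairSum n (λ k l → sum (λ i → F i k l))
sum-pairSum-comm zero    n F = sym (pairSum-zero n)
sum-pairSum-comm (suc m) n F = trans
  (cong (_+_ (pairSum n (F zero))) (sum-pairSum-comm m n (F ∘ suc)))
  (sym (pairSum-+ n (F zero) _))

pairSum-comm : ∀ m n (F : Fin m → Fin m → Fin n → Fin n → ℕ) →
               pairSum m (λ i j → pairSum n (F i j)) ≡ pairSum n (λ k l → pairSum m (λ i j → F i j k l))
pairSum-comm zero    n F = sym (pairSum-zero n)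
pairSum-comm (suc m) n F = trans
  (cong₂ _+_ (sum-pairSum-comm m n (F zero ∘ suc)) (pairSum-comm m n (λ i → F (suc i) ∘ suc)))
  (sym (pairSum-+ n (λ k l → sum (λ j → F zero (suc j) k l)) _))

-- A product of two sums, expanded into off-diagonal and diagonal terms. With `p = q` it computes
-- δ²; with `p` and `q` of disjoint support the diagonal vanishes and a product of cardinalities
-- remains.
pairSum-product : ∀ n (p q : Fin n → ℕ) →
  pairSum n (λ i j → p i * q j + q i * p j) + sum (λ i → p i * q i) ≡ sum p * sum q
pairSum-product zero    p q = refl
pairSum-product (suc n) p q = begin
  sum (λ j → p₀ * q⁺ j + q₀ * p⁺ j) + PS + (p₀ * q₀ + S)
    ≡⟨ cong (λ x → x + PS + (p₀ * q₀ + S)) (trans (∑-distrib-+ _ (λ j → q₀ * p⁺ j))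
         (sym (cong₂ _+_ (*-distribˡ-sum p₀ q⁺) (*-distribˡ-sum q₀ p⁺)))) ⟩
  p₀ * sum q⁺ + q₀ * sum p⁺ + PS + (p₀ * q₀ + S)
    ≡⟨ solve 6 (λ a b P Q X Y → a :* Q :+ b :* P :+ X :+ (a :* b :+ Y) := a :* b :+ a :* Q :+ b :* P :+ (X :+ Y))
         refl p₀ q₀ (sum p⁺) (sum q⁺) PS S ⟩
  p₀ * q₀ + p₀ * sum q⁺ + q₀ * sum p⁺ + (PS + S)
    ≡⟨ cong (_+_ (p₀ * q₀ + p₀ * sum q⁺ + q₀ * sum p⁺)) (pairSum-product n p⁺ q⁺) ⟩
  p₀ * q₀ + p₀ * sum q⁺ + q₀ * sum p⁺ + sum p⁺ * sum q⁺
    ≡⟨ solve 4 (λ a b P Q → a :* b :+ a :* Q :+ b :* P :+ P :* Q := (a :+ P) :* (b :+ Q)) refl p₀ q₀ (sum p⁺) (sum q⁺) ⟩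
  (p₀ + sum p⁺) * (q₀ + sum q⁺) ∎
  where
  open ≡-Reasoning
  open +-*-Solver
  p₀ = p zero
  q₀ = q zero
  p⁺ = p ∘ suc
  q⁺ = q ∘ suc
  PS = pairSum n (λ i j → p⁺ i * q⁺ j + q⁺ i * p⁺ j)
  S  = sum (λ i → p⁺ i * q⁺ i)

-- Cardinalities of subsets as sums of bits

bit : Bool → ℕ
bit true  = 1
bit false = 0

∣p∣≡sum : (p : Subset n) → ∣ p ∣ ≡ sum (bit ∘ lookup p)
∣p∣≡sum []          = refl
∣p∣≡sum (true  ∷ p) = cong suc (∣p∣≡sum p)
∣p∣≡sum (false ∷ p) = ∣p∣≡sum p

bit-∧ : ∀ x y → bit (x ∧ y) ≡ bit x * bit y
bit-∧ true  y = sym (*-identityˡ (bit y))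
bit-∧ false y = refl

∣p∩q∣≡sum : (p q : Subset n) → ∣ p ∩ q ∣ ≡ sum (λ i → bit (lookup p i) * bit (lookup q i))
∣p∩q∣≡sum p q = trans (∣p∣≡sum (p ∩ q)) $ sum-cong-≗ λ i →
  trans (cong bit (lookup-zipWith _∧_ i p q)) (bit-∧ (lookup p i) (lookup q i))

-- Isometric embeddings into hypercubes

≢-≢⇒≡ : {x y z : Bool} → x ≢ y → x ≢ z → y ≡ z
≢-≢⇒≡ {true}  {true}          x≢y x≢z = contradiction refl x≢y
≢-≢⇒≡ {true}  {false} {true}  x≢y x≢z = contradiction refl x≢z
≢-≢⇒≡ {true}  {false} {false} x≢y x≢z = refl
≢-≢⇒≡ {false} {false}         x≢y x≢z = contradiction refl x≢y
≢-≢⇒≡ {false} {true}  {false} x≢y x≢z = contradiction refl x≢z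
≢-≢⇒≡ {false} {true}  {true}  x≢y x≢z = refl

bit≤1 : ∀ x → bit x ≤ 1
bit≤1 true  = s≤s z≤n
bit≤1 false = z≤n

bit-xor-≡ : {x y : Bool} → x ≡ y → bit (x xor y) ≡ 0
bit-xor-≡ {x} refl = cong bit (xor-same x)

bit-xor-≢ : {x y : Bool} → x ≢ y → bit (x xor y) ≡ 1
bit-xor-≢ {true}  {true}  x≢y = contradiction refl x≢y
bit-xor-≢ {true}  {false} x≢y = refl
bit-xor-≢ {false} {true}  x≢y = refl
bit-xor-≢ {false} {false} x≢y = contradiction refl x≢y

infix 4 _∼_

_∼_ : Vec Bool D → Vec Bool D → Set
_∼_ {D} = Graph._~_ (Hypercube D)

hamming : Vec Bool D → Vec Bool D → ℕ
hamming {D} x y = ∑[ i < D ] bit (lookup x i xor lookup y i)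

-- Only the summand at the flipped coordinate can change, and it is at most 1.
hamming-step : (x w y : Vec Bool D) → x ∼ w → hamming x y ≤ suc (hamming w y)
hamming-step x w y (i , _ , x≡w) = begin
  hamming x y
    ≤⟨ sum-≤-except i (λ j j≢i → ≤-reflexive (cong (λ b → bit (b xor lookup y j)) (x≡w j j≢i))) ⟩
  bit (lookup x i xor lookup y i) + hamming w y
    ≤⟨ +-monoˡ-≤ (hamming w y) (bit≤1 (lookup x i xor lookup y i)) ⟩
  suc (hamming w y) ∎
  where open ≤-Reasoning

hamming≤length : ∀ {x y : Vec Bool D} → Walk (Hypercube D) x y k → hamming x y ≤ k
hamming≤length {D = D} {x = x} [] = ≤-reflexive $
  trans (sum-cong-≗ λ i → bit-xor-≡ {lookup x i} refl) (sum-replicate-zero D)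
hamming≤length (_∷_ {u = x} {w} {y} e p) = ≤-trans (hamming-step x w y e) (s≤s (hamming≤length p))

prepend : ∀ b {x y : Vec Bool D} → Walk (Hypercube D) x y k → Walk (Hypercube (suc D)) (b ∷ x) (b ∷ y) k
prepend b []                      = []
prepend b ((i , x≢w , x≡w) ∷ p) = (suc i , x≢w , λ where
  zero    _   → refl
  (suc j) j≢i → x≡w j (j≢i ∘ cong suc)) ∷ prepend b p

hammingWalk : (x y : Vec Bool D) → Walk (Hypercube D) x y (hamming x y)
hammingWalk []      []      = []
hammingWalk (a ∷ x) (b ∷ y) with a ≟ᵇ b
... | yes refl rewrite bit-xor-≡ {a} refl = prepend a (hammingWalk x y)
... | no  a≢b  rewrite bit-xor-≢ a≢b      = (zero , a≢b , λ where
  zero    0≢0 → contradiction refl 0≢0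
  (suc j) _   → refl) ∷ prepend b (hammingWalk x y)

hamming-isDistance : (x y : Vec Bool D) → IsDistance (Hypercube D) x y (hamming x y)
hamming-isDistance x y = hammingWalk x y , hamming≤length

-- `geodesic` asks only for a walk of Hamming length: the opposite bound follows from `adjacent`,
-- which sends walks of `G` to walks of the cube.
record IsometricEmbedding {n} (G : Graph (Fin n)) : Set where
  open Graph G
  field
    dimension : ℕ
    φ         : Fin n → Vec Bool dimension
    adjacent  : ∀ {u v} → u ~ v → φ u ∼ φ v
    geodesic  : ∀ u v → Walk G u v (hamming (φ u) (φ v))

-- Isometry, read backwards at the Hamming distance, yields a walk in the subgraph, which the
-- inverse isomorphism pulls back to `G`; `from (to u)` is then replaced by `u`.
partialCube⇒embedding : {G : Graph (Fin n)} → IsPartialCube G → IsometricEmbedding G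
partialCube⇒embedding {G = G} (D , H , isometric , G≅H) = record
  { dimension = D
  ; φ         = value ∘ to
  ; adjacent  = edge⇒~ ∘ Equivalence.to adjacency
  ; geodesic  = λ u v → subst₂ (λ u v → Walk G u v _) (strictlyInverseʳ u) (strictlyInverseʳ v) $
                  pull (proj₁ (Equivalence.from (isometric (to u) (to v) _) (hamming-isDistance _ _)))
  }
  where
  open Subgraph H
  open _≅_ G≅H
  open Inverse bijection
  pull : ∀ {x y} → Walk asGraph x y k → Walk G (from x) (from y) k
  pull []      = []
  pull (_∷_ {u = x} {w} e p) = Equivalence.from adjacency
    (subst₂ (λ x w → edge (value x) (value w)) (sym (strictlyInverseˡ x)) (sym (strictlyInverseˡ w)) e) ∷ pull p

-- Θ-classes as directions

module _ (G : Graph (Fin n)) where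
  open Graph G

  private
    candidates : List (Fin n × Fin n)
    candidates = cartesianProduct (allFin n) (allFin n)
    isEdge? : ∀ (p : Fin n × Fin n) → Dec (proj₁ p < proj₂ p × proj₁ p ~ proj₂ p)
    isEdge? = λ (u , v) → (u <? v) ×-dec (u ~? v)

  ends-adjacent : ∀ e → proj₁ (ends G e) ~ proj₂ (ends G e)
  ends-adjacent e = proj₂ (proj₂ (∈-filter⁻ isEdge? {xs = candidates} (∈-lookup e)))

  -- `edges` lists each edge with its smaller end first, so the order of `u` and `v` decides the
  -- orientation found.
  joiningEdge : ∀ {u v} → u ~ v → ∃ (Joins G u v)
  joiningEdge {u} {v} u~v with <-cmp u v
  ... | tri< u<v _ _  = let uv∈ = ∈-filter⁺ isEdge? (∈-cartesianProduct⁺ (∈-allFin u) (∈-allFin v)) (u<v , u~v)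
                        in index uv∈ , inj₁ (sym (lookup-index uv∈))
  ... | tri≈ _ refl _ = contradiction u~v ~-irrefl
  ... | tri> _ _ v<u  = let vu∈ = ∈-filter⁺ isEdge? (∈-cartesianProduct⁺ (∈-allFin v) (∈-allFin u)) (v<u , ~-sym u~v)
                        in index vu∈ , inj₂ (sym (lookup-index vu∈))

module EmbeddedGraph {G : Graph (Fin n)} (embedding : IsometricEmbedding G) where
  open Graph G
  open IsometricEmbedding embedding public

  coord : Fin dimension → Fin n → Bool
  coord i v = lookup (φ v) i

  hamming≤walk : ∀ {u v} → Walk G u v k → hamming (φ u) (φ v) ≤ k
  hamming≤walk = hamming≤length ∘ embed
    where
    embed : ∀ {u v} → Walk G u v k → Walk (Hypercube dimension) (φ u) (φ v) k
    embed []      = []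
    embed (e ∷ p) = adjacent e ∷ embed p

  dist≡hamming : ∀ u v → dist G u v ≡ hamming (φ u) (φ v)
  dist≡hamming u v =
    let shortest , minimal = dist-isDistance G (geodesic u v)
    in ≤-antisym (minimal (geodesic u v)) (hamming≤walk shortest)

  -- The one coordinate in which the images of the ends differ. Two edges turn out to be in relation
  -- `Θ` exactly when their directions agree.
  direction : Edge G → Fin dimension
  direction e = proj₁ (adjacent (ends-adjacent G e))

  direction-≢ : ∀ e → coord (direction e) (proj₁ (ends G e)) ≢ coord (direction e) (proj₂ (ends G e))
  direction-≢ e = proj₁ (proj₂ (adjacent (ends-adjacent G e)))

  direction-≡ : ∀ e i → i ≢ direction e → coord i (proj₁ (ends G e)) ≡ coord i (proj₂ (ends G e))
  direction-≡ e = proj₂ (proj₂ (adjacent (ends-adjacent G e)))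

  joins-≢⇒direction : ∀ {u v} e i → Joins G u v e → coord i u ≢ coord i v → direction e ≡ i
  joins-≢⇒direction {u} {v} e i j u≢v = decidable-stable (direction e ≟ i) λ d≢i →
    u≢v (sameCoord j (direction-≡ e i (d≢i ∘ sym)))
    where
    sameCoord : Joins G u v e → coord i (proj₁ (ends G e)) ≡ coord i (proj₂ (ends G e)) → coord i u ≡ coord i v
    sameCoord (inj₁ refl) eq = eq
    sameCoord (inj₂ refl) eq = sym eq

  joins⇒≢ : ∀ {u v} e → Joins G u v e → coord (direction e) u ≢ coord (direction e) v
  joins⇒≢ e (inj₁ refl) = direction-≢ e
  joins⇒≢ e (inj₂ refl) = direction-≢ e ∘ sym

  module _ (e f : Edge G) where
    private
      x = proj₁ (ends G e)
      y = proj₂ (ends G e)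
      u = proj₁ (ends G f)
      v = proj₂ (ends G f)

      differ : Fin n → Fin n → Fin dimension → ℕ
      differ a b i = bit (coord i a xor coord i b)

      -- Contributions of coordinate `i` to the two sides of the equation that `Θ` negates.
      straight crossed : Fin dimension → ℕ
      straight i = differ x u i + differ y v i
      crossed  i = differ x v i + differ y u i

      dist-+ : ∀ a b a′ b′ → dist G a b + dist G a′ b′ ≡ sum (λ i → differ a b i + differ a′ b′ i)
      dist-+ a b a′ b′ = trans (cong₂ _+_ (dist≡hamming a b) (dist≡hamming a′ b′))
                               (sym (∑-distrib-+ (differ a b) (differ a′ b′)))

      agree-e : ∀ i → i ≢ direction e → straight i ≡ crossed i
      agree-e i i≢e = trans
        (cong₂ (λ a b → bit (a xor coord i u) + bit (b xor coord i v)) (direction-≡ e i i≢e) (sym (direction-≡ e i i≢e)))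
        (+-comm (differ y u i) (differ x v i))

      agree-f : ∀ i → i ≢ direction f → straight i ≡ crossed i
      agree-f i i≢f =
        cong₂ (λ a b → bit (coord i x xor a) + bit (coord i y xor b)) (direction-≡ f i i≢f) (sym (direction-≡ f i i≢f))

      -- Of the two sums, one is 0 and the other 2.
      disagree : ∀ {a b c d} → a ≢ b → c ≢ d → bit (a xor c) + bit (b xor d) ≢ bit (a xor d) + bit (b xor c)
      disagree {true}  {true}  a≢b _ = contradiction refl a≢b
      disagree {false} {false} a≢b _ = contradiction refl a≢b
      disagree {_} {_} {true}  {true}  _ c≢d = contradiction refl c≢d
      disagree {_} {_} {false} {false} _ c≢d = contradiction refl c≢d
      disagree {true}  {false} {true}  {false} _ _ = λ ()
      disagree {true}  {false} {false} {true}  _ _ = λ ()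
      disagree {false} {true}  {true}  {false} _ _ = λ ()
      disagree {false} {true}  {false} {true}  _ _ = λ ()

    -- The ends of an edge agree off its direction, so exchanging them changes nothing there. If the
    -- directions differ, every coordinate is off at least one of them, and the two totals coincide.
    Θ⇒direction : Θ G e f → direction e ≡ direction f
    Θ⇒direction θ = decidable-stable (direction e ≟ direction f) λ e≢f → θ $
      trans (dist-+ x u y v) $ trans (sum-cong-≗ (agree e≢f)) $ sym (dist-+ x v y u)
      where
      agree : direction e ≢ direction f → ∀ i → straight i ≡ crossed i
      agree e≢f i with i ≟ direction e
      ... | no i≢e   = agree-e i i≢e
      ... | yes refl = agree-f i e≢f

    -- The contributions agree off the common direction, so equal totals would force agreement there
    -- too, against `disagree`.
    direction⇒Θ : direction e ≡ direction f → Θ G e f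
    direction⇒Θ e≡f eq = disagree (direction-≢ e)
      (subst (λ i → coord i u ≢ coord i v) (sym e≡f) (direction-≢ f)) $
      sym $ +-cancelˡ-≡ (sum straight) _ _ $ trans (sum-≡-except (direction e) agree-e) $
      cong (_+ straight (direction e)) (sym (trans (sym (dist-+ x u y v)) (trans eq (dist-+ x v y u))))

  -- Together with `hamming≤walk`, a bound `k ≤ hamming` says that a walk of length `k` is shortest;
  -- this passes to the tail of the walk.
  geodesicTail : ∀ {u w v} → u ~ w → suc k ≤ hamming (φ u) (φ v) → k ≤ hamming (φ w) (φ v)
  geodesicTail {u = u} {w} {v} u~w k<uv = s≤s⁻¹ (≤-trans k<uv (hamming-step (φ u) (φ w) (φ v) (adjacent u~w)))

  -- A geodesic never crosses a coordinate back. If `u` agreed with `v` at `i`, then `w`, differing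
  -- from `u` only there, would be no closer to `v` than `u` is, and the remaining `k` steps would
  -- be too few.
  geodesicStep : ∀ {u w v} i → coord i u ≢ coord i w → u ~ w → Walk G w v k →
                 suc k ≤ hamming (φ u) (φ v) → coord i w ≡ coord i v
  geodesicStep {k} {u} {w} {v} i u≢w u~w p k<uv = ≢-≢⇒≡ u≢w u≢v
    where
    -- The coordinate flipped by `u~w` must be `i`, since `u` and `w` differ at `i` and adjacent
    -- vertices differ at one coordinate only.
    u≡w : ∀ j → j ≢ i → coord j u ≡ coord j w
    u≡w j j≢i = proj₂ (proj₂ (adjacent u~w)) j λ { refl → u≢w (proj₂ (proj₂ (adjacent u~w)) i (j≢i ∘ sym)) }
    u≢v : coord i u ≢ coord i v
    u≢v u≡v = <-irrefl refl $ begin-strict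
      k
        <⟨ k<uv ⟩
      hamming (φ u) (φ v)
        ≤⟨ sum-≤-except i (λ j j≢i → ≤-reflexive (cong (λ b → bit (b xor coord j v)) (u≡w j j≢i))) ⟩
      bit (coord i u xor coord i v) + hamming (φ w) (φ v)
        ≡⟨ cong (_+ hamming (φ w) (φ v)) (bit-xor-≡ u≡v) ⟩
      hamming (φ w) (φ v)
        ≤⟨ hamming≤walk p ⟩
      k ∎
      where open ≤-Reasoning

  module _ (C : EdgeSet G) (i : Fin dimension) (C-is-cut : ∀ f → f ∈ C ⇔ direction f ≡ i) where

    -- A step that changed coordinate `i` would use an edge of direction `i`, and all of these are
    -- deleted.
    cut-invariant : ∀ {u v} → Walk (G ─ C) u v k → coord i u ≡ coord i v
    cut-invariant [] = refl
    cut-invariant (_∷_ {u = u} {w} (u~w , kept) p) = trans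
      (decidable-stable (coord i u ≟ᵇ coord i w) λ u≢w →
        let e , j = joiningEdge G u~w
        in kept (e , Equivalence.from (C-is-cut e) (joins-≢⇒direction e i j u≢w) , j))
      (cut-invariant p)

    -- A geodesic between vertices that agree at `i` never crosses `i`, since by `geodesicStep` it
    -- could not cross back; hence it survives the deletion of `C`.
    cut-connected : ∀ u v → coord i u ≡ coord i v → ∃ (Walk (G ─ C) u v)
    cut-connected u v u≡v = _ , avoid u≡v (geodesic u v) ≤-refl
      where
      avoid : ∀ {u v} → coord i u ≡ coord i v → Walk G u v k → k ≤ hamming (φ u) (φ v) → Walk (G ─ C) u v k
      avoid u≡v []      _    = []
      avoid u≡v (_∷_ {u = u} {w} {v} u~w p) k<uv with coord i u ≟ᵇ coord i w
      ... | no u≢w  = contradiction (trans u≡v (sym (geodesicStep i u≢w u~w p k<uv))) u≢w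
      ... | yes u≡w = (u~w , kept) ∷ avoid (trans (sym u≡w) u≡v) p (geodesicTail u~w k<uv)
        where
        kept : ¬ (∃ λ e → e ∈ C × Joins G u w e)
        kept (e , e∈C , j) = joins⇒≢ e j $
          subst (λ d → coord d u ≡ coord d w) (sym (Equivalence.to (C-is-cut e) e∈C)) u≡w

-- Distance in the line graph

does-∈? : ∀ (x : Fin n) p → does (x ∈? p) ≡ lookup p x
does-∈? x p with lookup p x in eq
... | true  = dec-true (x ∈? p) (lookup⇒[]= x p eq)
... | false = dec-false (x ∈? p) λ x∈p → contradiction (trans (sym ([]=⇒lookup x∈p)) eq) λ ()

-- `not (a xor b)` is the Boolean test for `a ≡ b`; in this form sides can be computed with.
∈⇔≡⇒lookup : ∀ {x : Fin n} {p a b} → x ∈ p ⇔ a ≡ b → lookup p x ≡ not (a xor b)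
∈⇔≡⇒lookup {x = x} {p} {a} {b} x∈p⇔a≡b with lookup p x in eq
... | true with refl ← Equivalence.to x∈p⇔a≡b (lookup⇒[]= x p eq) = sym (cong not (xor-same a))
∈⇔≡⇒lookup {x = x} {p} {a} {b} x∈p⇔a≡b | false with a | b
... | true  | false = refl
... | false | true  = refl
... | true  | true  = contradiction (trans (sym eq) ([]=⇒lookup (Equivalence.from x∈p⇔a≡b refl))) λ ()
... | false | false = contradiction (trans (sym eq) ([]=⇒lookup (Equivalence.from x∈p⇔a≡b refl))) λ ()

not-xor-≢ : ∀ {a b} c → a ≢ b → not (b xor c) ≡ not (not (a xor c))
not-xor-≢ {true}  {true}  c a≢b = contradiction refl a≢b
not-xor-≢ {false} {false} c a≢b = contradiction refl a≢b
not-xor-≢ {true}  {false} c a≢b = sym (cong not (not-involutive c))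
not-xor-≢ {false} {true}  c a≢b = refl

xor-not-xor : ∀ a b c → not (a xor b) xor not (a xor c) ≡ b xor c
xor-not-xor true  b     c     = cong₂ _xor_ (not-involutive b) (not-involutive c)
xor-not-xor false true  true  = refl
xor-not-xor false true  false = refl
xor-not-xor false false true  = refl
xor-not-xor false false false = refl

bit-separate : ∀ a b → bit a * bit (not b) + bit (not a) * bit b ≡ bit (a xor b)
bit-separate true  true  = refl
bit-separate true  false = refl
bit-separate false true  = refl
bit-separate false false = refl

bit-*-idem : ∀ a → bit a * bit a ≡ bit a
bit-*-idem true  = refl
bit-*-idem false = refl

bit-*-not : ∀ a → bit a * bit (not a) ≡ 0
bit-*-not true  = refl
bit-*-not false = refl

lookup-edgesWithin : ∀ (G : Graph (Fin n)) F W e → lookup (edgesWithin G F W) e ≡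
  not (lookup F e) ∧ (lookup W (proj₁ (ends G e)) ∧ lookup W (proj₂ (ends G e)))
lookup-edgesWithin G F W e = trans (lookup∘tabulate _ e) $
  cong₂ _∧_ (cong not (does-∈? e F)) (cong₂ _∧_ (does-∈? (proj₁ (ends G e)) W) (does-∈? (proj₂ (ends G e)) W))

joins⇒ends : ∀ (G : Graph (Fin n)) {u v} e → Joins G u v e → _endOf_ G u e × _endOf_ G v e
joins⇒ends G e (inj₁ refl) = inj₁ refl , inj₂ refl
joins⇒ends G e (inj₂ refl) = inj₂ refl , inj₁ refl

-- The edges of the walk, preceded by `e` and followed by `f`, form the line-graph walk. Its length
-- is only bounded, because equal consecutive edges are skipped.
lineWalk : (G : Graph (Fin n)) → ∀ {u v e f} → Walk G u v k → _endOf_ G u e → _endOf_ G v f →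
           ∃ λ l → l ≤ suc k × Walk (LineGraph G) e f l
lineWalk G {e = e} {f} [] u∈e u∈f with e ≟ f
... | yes refl = 0 , z≤n , []
... | no  e≢f  = 1 , s≤s z≤n , (e≢f , _ , u∈e , u∈f) ∷ []
lineWalk G {u} {e = e} {f} (_∷_ {v = w} u~w p) u∈e v∈f with joiningEdge G u~w
... | g , joins with (u∈g , w∈g) ← joins⇒ends G g joins with l , l≤k , q ← lineWalk G p w∈g v∈f with e ≟ g
... | yes refl = l , m≤n⇒m≤1+n l≤k , q
... | no  e≢g  = suc l , s≤s l≤k , (e≢g , u , u∈e , u∈g) ∷ q

-- Sides of the Θ-cuts

module ΘCuts
  {G : Graph (Fin n)} (embedding : IsometricEmbedding G)
  {E : Fin d → EdgeSet G} (classes : AreΘClasses G E)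
  {U U′ : Fin d → Subset n} (components : ∀ k → AreTheTwoComponents (G ─ E k) (U k) (U′ k))
  where

  open Graph G
  open EmbeddedGraph embedding
  open AreΘClasses classes using (isClass; complete) renaming (distinct to E-injective)
  module Components k = AreTheTwoComponents (components k)

  -- The cube coordinate flipped by the edges of class `k`. A coordinate that no edge flips is the
  -- axis of no class.
  axis : Fin d → Fin dimension
  axis k = direction (proj₁ (isClass k))

  class : Edge G → Fin d
  class e = proj₁ (complete e)

  ∈⇔axis : ∀ k f → f ∈ E k ⇔ direction f ≡ axis k
  ∈⇔axis k f =
    let e , f∈⇔Θ = isClass k
    in mk⇔ (sym ∘ Θ⇒direction e f ∘ Equivalence.to (f∈⇔Θ f))
           (Equivalence.from (f∈⇔Θ f) ∘ direction⇒Θ e f ∘ sym)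

  ∈class : ∀ e → e ∈ E (class e)
  ∈class e = Equivalence.from (proj₂ (complete e) e) (direction⇒Θ e e refl)

  direction≡axis : ∀ e → direction e ≡ axis (class e)
  direction≡axis e = Equivalence.to (∈⇔axis (class e) e) (∈class e)

  -- Membership in a class depends only on its axis, so equal axes give equal edge sets and
  -- `E-injective` applies.
  axis-injective : ∀ {k l} → axis k ≡ axis l → k ≡ l
  axis-injective eq = E-injective (⊆-antisym (include eq) (include (sym eq)))
    where
    include : ∀ {k l f} → axis k ≡ axis l → f ∈ E k → f ∈ E l
    include {k} {l} {f} eq = Equivalence.from (∈⇔axis l f) ∘ (λ d≡k → trans d≡k eq) ∘ Equivalence.to (∈⇔axis k f)

  ∈⇒class : ∀ {k e} → e ∈ E k → k ≡ class e
  ∈⇒class {k} {e} e∈E = axis-injective (trans (sym (Equivalence.to (∈⇔axis k e) e∈E)) (direction≡axis e))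

  side side′ : Fin d → Fin n → Bool
  side  k = lookup (U k)
  side′ k = lookup (U′ k)

  -- By `cut-invariant` and `cut-connected`, the component of `r` consists of the vertices that
  -- agree with `r` on the axis.
  component⇒side : ∀ {k W} ((r , _) : IsComponent (G ─ E k) W) w →
                   lookup W w ≡ not (coord (axis k) r xor coord (axis k) w)
  component⇒side {k} (r , w∈⇔walk) w = ∈⇔≡⇒lookup (mk⇔
    (λ w∈W → cut-invariant (E k) (axis k) (∈⇔axis k) (proj₂ (Equivalence.to (w∈⇔walk w) w∈W)))
    (λ eq → Equivalence.from (w∈⇔walk w) (cut-connected (E k) (axis k) (∈⇔axis k) r w eq)))

  -- If the roots of the two components agreed on the axis, the components would be equal; so the
  -- roots, and with them the memberships, are opposite.
  side′≡not-side : ∀ k w → side′ k w ≡ not (side k w)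
  side′≡not-side k w = begin
    side′ k w                           ≡⟨ component⇒side isComponent′ w ⟩
    not (coord (axis k) r′ xor coord (axis k) w) ≡⟨ not-xor-≢ (coord (axis k) w) r≢r′ ⟩
    not (not (coord (axis k) r xor coord (axis k) w)) ≡⟨ cong not (component⇒side isComponent w) ⟨
    not (side k w)                      ∎
    where
    open ≡-Reasoning
    open Components k
    r  = proj₁ isComponent
    r′ = proj₁ isComponent′
    same : ∀ {a b} → coord (axis k) a ≡ coord (axis k) b → ∀ w →
           not (coord (axis k) a xor coord (axis k) w) ≡ not (coord (axis k) b xor coord (axis k) w)
    same eq w = cong (λ c → not (c xor coord (axis k) w)) eq
    r≢r′ : coord (axis k) r ≢ coord (axis k) r′
    r≢r′ eq = distinct (⊆-antisym
      (λ {w} w∈U → lookup⇒[]= w (U′ k) (trans (component⇒side isComponent′ w) (trans (same (sym eq) w)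
        (trans (sym (component⇒side isComponent w)) ([]=⇒lookup w∈U)))))
      (λ {w} w∈U′ → lookup⇒[]= w (U k) (trans (component⇒side isComponent w) (trans (same eq w)
        (trans (sym (component⇒side isComponent′ w)) ([]=⇒lookup w∈U′))))))

  -- The root of the component cancels under xor.
  side-xor : ∀ k u v → side k u xor side k v ≡ coord (axis k) u xor coord (axis k) v
  side-xor k u v = trans (cong₂ _xor_ (component⇒side isComponent u) (component⇒side isComponent v))
                             (xor-not-xor (coord (axis k) (proj₁ isComponent)) (coord (axis k) u) (coord (axis k) v))
    where open Components k

  sideDist : Fin n → Fin n → ℕ
  sideDist u v = ∑[ k < d ] bit (side k u xor side k v)

  -- Each step crosses the class of its edge and no later step undoes that, so every step accounts
  -- for a class of its own.
  geodesic≤sideDist : ∀ {u v} → Walk G u v k → k ≤ hamming (φ u) (φ v) → k ≤ sideDist u v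
  geodesic≤sideDist p k≤uv = ≤-trans (count p k≤uv) (≤-reflexive (sum-cong-≗ λ k → cong bit (sym (side-xor k _ _))))
    where
    axisDiffer : Fin n → Fin n → Fin d → ℕ
    axisDiffer u v k = bit (coord (axis k) u xor coord (axis k) v)
    count : ∀ {u v} → Walk G u v k → k ≤ hamming (φ u) (φ v) → k ≤ sum (axisDiffer u v)
    count []      _    = z≤n
    count {suc k} (_∷_ {u = u} {w} {v} u~w p) k<uv =
      let e , joins = joiningEdge G u~w
          c = class e
          u≢w = subst (λ i → coord i u ≢ coord i w) (direction≡axis e) (joins⇒≢ e joins)
          -- `w` is already on the side of `v`, so class `c` counts for `u` but not for `w`; the
          -- step leaves all other axes alone.
          w≡v = geodesicStep (axis c) u≢w u~w p k<uv
          u≡w = λ j j≢c → decidable-stable (coord (axis j) u ≟ᵇ coord (axis j) w) λ ne →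
                  j≢c (axis-injective (trans (sym (joins-≢⇒direction e (axis j) joins ne)) (direction≡axis e)))
      in begin
        suc k
          ≤⟨ s≤s (count p (geodesicTail u~w k<uv)) ⟩
        1 + sum (axisDiffer w v)
          ≡⟨ +-comm 1 _ ⟩
        sum (axisDiffer w v) + 1
          ≡⟨ cong (_+_ (sum (axisDiffer w v))) (bit-xor-≢ (λ u≡v → u≢w (trans u≡v (sym w≡v)))) ⟨
        sum (axisDiffer w v) + axisDiffer u v c
          ≡⟨ sum-≡-except c (λ j j≢c → cong (λ b → bit (b xor coord (axis j) v)) (u≡w j j≢c)) ⟨
        sum (axisDiffer u v) + axisDiffer w v c
          ≡⟨ cong (_+_ (sum (axisDiffer u v))) (bit-xor-≡ w≡v) ⟩
        sum (axisDiffer u v) + 0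
          ≡⟨ +-identityʳ _ ⟩
        sum (axisDiffer u v) ∎
      where open ≤-Reasoning

  -- Edges within the sides and their separation

  within within′ : Fin d → Edge G → Bool
  within  k = lookup (edgesWithin G (E k) (U k))
  within′ k = lookup (edgesWithin G (E k) (U′ k))

  side-≡ : ∀ {k e} → k ≢ class e → side k (proj₁ (ends G e)) ≡ side k (proj₂ (ends G e))
  side-≡ {k} {e} k≢e = trans (component⇒side isComponent _) $ trans
    (cong (λ c → not (coord (axis k) (proj₁ isComponent) xor c))
      (direction-≡ e (axis k) λ eq → k≢e (axis-injective (trans eq (direction≡axis e)))))
    (sym (component⇒side isComponent _))
    where open Components k

  side-≢ : ∀ e → side (class e) (proj₁ (ends G e)) ≢ side (class e) (proj₂ (ends G e))
  side-≢ e eq = contradiction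
    (trans (sym (bit-xor-≡ eq)) (trans (cong bit (side-xor (class e) _ _)) (bit-xor-≢
      (subst (λ i → coord i (proj₁ (ends G e)) ≢ coord i (proj₂ (ends G e))) (direction≡axis e) (direction-≢ e))))) λ ()

  within-cut : ∀ {k e} W → k ≡ class e → lookup (edgesWithin G (E k) W) e ≡ false
  within-cut {k} {e} W refl = trans (lookup-edgesWithin G (E k) W e)
    (cong (λ b → not b ∧ _) ([]=⇒lookup (∈class e)))

  within-uncut : ∀ {k e} W → k ≢ class e → lookup W (proj₁ (ends G e)) ≡ lookup W (proj₂ (ends G e)) →
                 ∀ {v} → _endOf_ G v e → lookup (edgesWithin G (E k) W) e ≡ lookup W v
  within-uncut {k} {e} W k≢e same v∈e = trans (lookup-edgesWithin G (E k) W e) $ trans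
    (cong₂ (λ a b → not a ∧ (b ∧ lookup W (proj₂ (ends G e)))) e∉E same) $ trans (∧-idem _) (end v∈e)
    where
    e∉E : lookup (E k) e ≡ false
    e∉E = trans (sym (does-∈? e (E k))) (dec-false (e ∈? E k) (k≢e ∘ ∈⇒class))
    end : ∀ {v} → _endOf_ G v e → lookup W (proj₂ (ends G e)) ≡ lookup W v
    end (inj₁ refl) = sym same
    end (inj₂ refl) = refl

  within≡side : ∀ {k e v} → k ≢ class e → _endOf_ G v e → within k e ≡ side k v
  within≡side {k} k≢e = within-uncut (U k) k≢e (side-≡ k≢e)

  within′≡not-side : ∀ {k e v} → k ≢ class e → _endOf_ G v e → within′ k e ≡ not (side k v)
  within′≡not-side {k} k≢e v∈e = trans
    (within-uncut (U′ k) k≢e (trans (side′≡not-side k _) (trans (cong not (side-≡ k≢e)) (sym (side′≡not-side k _)))) v∈e)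
    (side′≡not-side k _)

  inside inside′ : Fin d → Edge G → ℕ
  inside  k e = bit (within k e)
  inside′ k e = bit (within′ k e)

  inside-disjoint : ∀ k e → inside k e * inside′ k e ≡ 0
  inside-disjoint k e with k ≟ class e
  ... | yes k≡e = cong (λ b → bit b * inside′ k e) (within-cut (U k) k≡e)
  ... | no  k≢e = trans (cong₂ (λ a b → bit a * bit b) (within≡side k≢e (inj₁ refl)) (within′≡not-side k≢e (inj₁ refl)))
                        (bit-*-not (side k (proj₁ (ends G e))))

  -- The 0/1 indicator that `k` puts `e` and `f` on opposite sides, written with products so that
  -- sums over pairs of edges factor. An edge of `E k` lies within neither side and gives 0.
  separates : Fin d → Edge G → Edge G → ℕ
  separates k e f = inside k e * inside′ k f + inside′ k e * inside k f

  separates-cutˡ : ∀ {k e} f → k ≡ class e → separates k e f ≡ 0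
  separates-cutˡ {k} f k≡e = cong₂ (λ a b → bit a * inside′ k f + bit b * inside k f)
                                   (within-cut (U k) k≡e) (within-cut (U′ k) k≡e)

  separates-cutʳ : ∀ {k f} e → k ≡ class f → separates k e f ≡ 0
  separates-cutʳ {k} e k≡f = trans
    (cong₂ (λ a b → inside k e * bit b + inside′ k e * bit a) (within-cut (U k) k≡f) (within-cut (U′ k) k≡f))
    (cong₂ _+_ (*-zeroʳ (inside k e)) (*-zeroʳ (inside′ k e)))

  separates-sides : ∀ {k e f u v} → k ≢ class e → k ≢ class f → _endOf_ G u e → _endOf_ G v f →
                    separates k e f ≡ bit (side k u xor side k v)
  separates-sides {k} {u = u} {v} k≢e k≢f u∈e v∈f = trans
    (cong₂ _+_ (cong₂ (λ a b → bit a * bit b) (within≡side k≢e u∈e) (within′≡not-side k≢f v∈f))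
               (cong₂ (λ a b → bit a * bit b) (within′≡not-side k≢e u∈e) (within≡side k≢f v∈f)))
    (bit-separate (side k u) (side k v))

  separates-bit : ∀ k e f → ∃ λ b → separates k e f ≡ bit b
  separates-bit k e f with k ≟ class e | k ≟ class f
  ... | yes k≡e | _       = false , separates-cutˡ f k≡e
  ... | no _    | yes k≡f = false , separates-cutʳ e k≡f
  ... | no k≢e  | no k≢f  = _ , separates-sides k≢e k≢f (inj₁ refl) (inj₁ refl)

  separates-idem : ∀ k e f → separates k e f * separates k e f ≡ separates k e f
  separates-idem k e f with separates k e f | separates-bit k e f
  ... | _ | b , refl = bit-*-idem b

  separates≤1 : ∀ k e f → separates k e f ≤ 1
  separates≤1 k e f = let b , eq = separates-bit k e f in subst (_≤ 1) (sym eq) (bit≤1 b)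

  -- An edge outside `E k` lies on the side of each of its ends, so `e` and `g` share the side of
  -- `v`. Only `≤` holds, because `e` may belong to `E k`, which makes the left side 0.
  separates-step : ∀ {k e g v} f → k ≢ class g → _endOf_ G v e → _endOf_ G v g → separates k e f ≤ separates k g f
  separates-step {k} {e} {g} f k≢g v∈e v∈g with k ≟ class e | k ≟ class f
  ... | yes k≡e | _       = subst (_≤ separates k g f) (sym (separates-cutˡ f k≡e)) z≤n
  ... | no _    | yes k≡f = subst (_≤ separates k g f) (sym (separates-cutʳ e k≡f)) z≤n
  ... | no k≢e  | no k≢f  = ≤-reflexive (trans (separates-sides k≢e k≢f v∈e (inj₁ refl))
                                               (sym (separates-sides k≢g k≢f v∈g (inj₁ refl))))

  separates-incident : ∀ k {e f v} → _endOf_ G v e → _endOf_ G v f → separates k e f ≡ 0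
  separates-incident k {e} {f} {v} v∈e v∈f with k ≟ class e | k ≟ class f
  ... | yes k≡e | _       = separates-cutˡ f k≡e
  ... | no _    | yes k≡f = separates-cutʳ e k≡f
  ... | no k≢e  | no k≢f  = trans (separates-sides k≢e k≢f v∈e v∈f) (bit-xor-≡ {side k v} refl)

  separation : Edge G → Edge G → ℕ
  separation e f = ∑[ k < d ] separates k e f

  -- The last step joins incident edges, separated by no class: hence the bound `k` for length
  -- `suc k`. Every earlier step loses at most the summand at the class of the edge it reaches.
  separation<walk : ∀ {e f} → Walk (LineGraph G) e f (suc k) → separation e f ≤ k
  separation<walk ((_ , _ , v∈e , v∈f) ∷ []) = ≤-reflexive $
    trans (sum-cong-≗ λ k → separates-incident k v∈e v∈f) (sum-replicate-zero d)
  separation<walk {suc k} {e} {f} (_∷_ {v = g} (_ , _ , v∈e , v∈g) p@(_ ∷ _)) = begin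
    separation e f                              ≤⟨ sum-≤-except (class g) (λ _ k≢g → separates-step f k≢g v∈e v∈g) ⟩
    separates (class g) e f + separation g f    ≤⟨ +-mono-≤ (separates≤1 (class g) e f) (separation<walk p) ⟩
    suc k                                       ∎
    where open ≤-Reasoning

  endOnSide : ∀ e b → ∃ λ v → _endOf_ G v e × side (class e) v ≡ b
  endOnSide e b with side (class e) (proj₁ (ends G e)) ≟ᵇ b
  ... | yes eq = _ , inj₁ refl , eq
  ... | no  ne = _ , inj₂ refl , ≢-≢⇒≡ (side-≢ e) ne

  -- `u` is chosen on the side of `f` with respect to the class of `e`, then `v` on the side of `u`
  -- with respect to the class of `f`. These two classes separate neither the edges nor the chosen
  -- ends.
  closestEnds : ∀ e f → ∃ λ u → ∃ λ v → _endOf_ G u e × _endOf_ G v f × sideDist u v ≤ separation e f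
  closestEnds e f =
    let u , u∈e , u≡f = endOnSide e (side (class e) (proj₁ (ends G f)))
        v , v∈f , v≡u = endOnSide f (side (class f) u)
    in u , v , u∈e , v∈f , sum-mono (differ≤separates u v u∈e v∈f u≡f v≡u)
    where
    differ≤separates : ∀ u v → _endOf_ G u e → _endOf_ G v f → side (class e) u ≡ side (class e) (proj₁ (ends G f)) →
      side (class f) v ≡ side (class f) u → ∀ k → bit (side k u xor side k v) ≤ separates k e f
    differ≤separates u v u∈e v∈f u≡f v≡u k with k ≟ class f | k ≟ class e
    -- This also covers a class shared by `e` and `f`, since `v` was matched to `u` last.
    ... | yes refl | _        = subst (_≤ separates k e f) (sym (bit-xor-≡ (sym v≡u))) z≤n
    ... | no k≢f   | yes refl = subst (_≤ separates k e f) (sym (bit-xor-≡ (trans u≡f (at-end v∈f)))) z≤n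
      where
      at-end : ∀ {v} → _endOf_ G v f → side k (proj₁ (ends G f)) ≡ side k v
      at-end (inj₁ refl) = refl
      at-end (inj₂ refl) = side-≡ k≢f
    ... | no k≢f   | no k≢e   = ≤-reflexive (sym (separates-sides k≢e k≢f u∈e v∈f))

  -- The upper bound turns a geodesic between the closest ends into a line-graph walk. Distinctness
  -- rules out the empty walk, for which the lower bound fails.
  edgeDist≡ : ∀ {e f} → e ≢ f → edgeDist G e f ≡ suc (separation e f)
  edgeDist≡ {e} {f} e≢f =
    let u , v , u∈e , v∈f , uv≤ef = closestEnds e f
        l , l≤ , p = lineWalk G (geodesic u v) u∈e v∈f
        shortest , minimal = dist-isDistance (LineGraph G) p
    in ≤-antisym (≤-trans (minimal p) (≤-trans l≤ (s≤s (≤-trans (geodesic≤sideDist (geodesic u v) ≤-refl) uv≤ef))))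
                 (lower shortest)
    where
    lower : ∀ {k} → Walk (LineGraph G) e f k → suc (separation e f) ≤ k
    lower []        = contradiction refl e≢f
    lower p@(_ ∷ _) = s≤s (separation<walk p)

-- Counting separated pairs

module _
  {G : Graph (Fin n)} (embedding : IsometricEmbedding G)
  {E : Fin d → EdgeSet G} (classes : AreΘClasses G E)
  {U U′ : Fin d → Subset n} (components : ∀ k → AreTheTwoComponents (G ─ E k) (U k) (U′ k))
  where

  open ΘCuts embedding classes components

  doublySeparated : Edge G → Edge G → ℕ
  doublySeparated e f = pairSum d λ k l → separates k e f * separates l e f

  crossings : Fin d → Fin d → ℕ
  crossings k l = ∣ W k ∩ W l ∣ * ∣ W′ k ∩ W′ l ∣ + ∣ W k ∩ W′ l ∣ * ∣ W′ k ∩ W l ∣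
    where
    W W′ : Fin d → EdgeSet G
    W  k = edgesWithin G (E k) (U k)
    W′ k = edgesWithin G (E k) (U′ k)

  -- The diagonal terms are squares of 0/1 values, so they add up to the separation itself.
  separation² : ∀ e f → 2 * doublySeparated e f + separation e f ≡ separation e f * separation e f
  separation² e f = begin
    2 * doublySeparated e f + separation e f
      ≡⟨ cong₂ _+_ (trans (cong (_+_ (doublySeparated e f)) (+-identityʳ _)) (sym (pairSum-+ d products products)))
                   (sum-cong-≗ λ k → sym (separates-idem k e f)) ⟩
    pairSum d (λ k l → products k l + products k l) + sum (λ k → products k k)
      ≡⟨ pairSum-product d (λ k → separates k e f) (λ k → separates k e f) ⟩
    separation e f * separation e f ∎
    where
    open ≡-Reasoning
    products : Fin d → Fin d → ℕ
    products k l = separates k e f * separates l e f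

  -- The pointwise formula, doubled and cleared of subtraction. Written as `1 + 1`, the constant
  -- later splits into two constant sums, each a binomial coefficient.
  edgeDist-identity : ∀ {e f} → e ≢ f →
    edgeDist G e f + edgeDist G e f ^ 2 + (1 + 1) ≡ 4 * edgeDist G e f + 2 * doublySeparated e f
  edgeDist-identity {e} {f} e≢f rewrite edgeDist≡ e≢f = begin
    suc δ + suc δ ^ 2 + 2
      ≡⟨ solve 1 (λ x → con 1 :+ x :+ (con 1 :+ x) :^ 2 :+ con 2 := con 4 :+ con 3 :* x :+ x :* x) refl δ ⟩
    4 + 3 * δ + δ * δ
      ≡⟨ cong (_+_ (4 + 3 * δ)) (separation² e f) ⟨
    4 + 3 * δ + (2 * P + δ)
      ≡⟨ solve 2 (λ x y → con 4 :+ con 3 :* x :+ (con 2 :* y :+ x) := con 4 :* (con 1 :+ x) :+ con 2 :* y) refl δ P ⟩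
    4 * suc δ + 2 * P ∎
    where
    open ≡-Reasoning
    open +-*-Solver
    δ = separation e f
    P = doublySeparated e f

  -- Disjointness kills the diagonal of `pairSum-product`.
  pairSum-separated : ∀ p q → (∀ e → p e * q e ≡ 0) →
    pairSum (size G) (λ e f → p e * q f + q e * p f) ≡ sum p * sum q
  pairSum-separated p q p*q≡0 = trans (sym (+-identityʳ _)) $ trans
    (cong (_+_ (pairSum (size G) _)) (sym (trans (sum-cong-≗ p*q≡0) (sum-replicate-zero (size G)))))
    (pairSum-product (size G) p q)

  -- `p`, `q`, `r`, `s` are the indicators of the four intersections. Multiplying out couples `p`
  -- with `q` and `r` with `s`, symmetrically in `e` and `f`, so each couple gives one product of
  -- cardinalities.
  pairSum-crossings : ∀ k l → pairSum (size G) (λ e f → separates k e f * separates l e f) ≡ crossings k l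
  pairSum-crossings k l = begin
    pairSum (size G) (λ e f → separates k e f * separates l e f)
      ≡⟨ pairSum-cong (size G) (λ e f _ → expand (inside k e) (inside′ k e) (inside k f) (inside′ k f)
                                               (inside l e) (inside′ l e) (inside l f) (inside′ l f)) ⟩
    pairSum (size G) (λ e f → p e * q f + q e * p f + (r e * s f + s e * r f))
      ≡⟨ pairSum-+ (size G) _ (λ e f → r e * s f + s e * r f) ⟩
    pairSum (size G) (λ e f → p e * q f + q e * p f) + pairSum (size G) (λ e f → r e * s f + s e * r f)
      ≡⟨ cong₂ _+_ (pairSum-separated p q λ e → disjoint (inside k e) _ (inside′ k e) _ (inside-disjoint k e))
                   (pairSum-separated r s λ e → disjoint (inside k e) _ (inside′ k e) _ (inside-disjoint k e)) ⟩
    sum p * sum q + sum r * sum s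
      ≡⟨ cong₂ _+_ (cong₂ _*_ (∣p∩q∣≡sum (W k) (W l)) (∣p∩q∣≡sum (W′ k) (W′ l)))
                   (cong₂ _*_ (∣p∩q∣≡sum (W k) (W′ l)) (∣p∩q∣≡sum (W′ k) (W l))) ⟨
    crossings k l ∎
    where
    open ≡-Reasoning
    W W′ : Fin d → EdgeSet G
    W  k = edgesWithin G (E k) (U k)
    W′ k = edgesWithin G (E k) (U′ k)
    p q r s : Edge G → ℕ
    p e = inside k e * inside l e
    q e = inside′ k e * inside′ l e
    r e = inside k e * inside′ l e
    s e = inside′ k e * inside l e
    expand : ∀ a a′ b b′ c c′ x x′ → (a * b′ + a′ * b) * (c * x′ + c′ * x) ≡
      a * c * (b′ * x′) + a′ * c′ * (b * x) + (a * c′ * (b′ * x) + a′ * c * (b * x′))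
    expand = solve 8 (λ a a′ b b′ c c′ x x′ → (a :* b′ :+ a′ :* b) :* (c :* x′ :+ c′ :* x) :=
      a :* c :* (b′ :* x′) :+ a′ :* c′ :* (b :* x) :+ (a :* c′ :* (b′ :* x) :+ a′ :* c :* (b :* x′))) refl
      where open +-*-Solver
    disjoint : ∀ a b a′ b′ → a * a′ ≡ 0 → a * b * (a′ * b′) ≡ 0
    disjoint a b a′ b′ aa′≡0 = trans
      (solve 4 (λ a b a′ b′ → a :* b :* (a′ :* b′) := a :* a′ :* (b :* b′)) refl a b a′ b′)
      (cong (_* (b * b′)) aa′≡0)
      where open +-*-Solver

  -- Twice the desired formula, over the naturals. Multiples are spelled as repeated additions so
  -- that `pairSum-+` splits them and `/1-homo-+` carries them over summand by summand.
  wiener-identity :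
    edgeWiener G + pairSum (size G) (λ e f → edgeDist G e f ^ 2) + (size G C 2 + size G C 2) ≡
    edgeWiener G + edgeWiener G + (edgeWiener G + edgeWiener G) + (pairSum d crossings + pairSum d crossings)
  wiener-identity = begin
    edgeWiener G + pairSum m (λ e f → ρ e f ^ 2) + (m C 2 + m C 2)
      ≡⟨ cong (_+_ (edgeWiener G + pairSum m (λ e f → ρ e f ^ 2))) (cong₂ _+_ (pairSum-one m) (pairSum-one m)) ⟨
    edgeWiener G + pairSum m (λ e f → ρ e f ^ 2) + (pairSum m (λ _ _ → 1) + pairSum m (λ _ _ → 1))
      ≡⟨ cong₂ _+_ (pairSum-+ m ρ _) (pairSum-+ m (λ _ _ → 1) _) ⟨
    pairSum m (λ e f → ρ e f + ρ e f ^ 2) + pairSum m (λ _ _ → 1 + 1)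
      ≡⟨ pairSum-+ m _ _ ⟨
    pairSum m (λ e f → ρ e f + ρ e f ^ 2 + (1 + 1))
      ≡⟨ pairSum-cong m (λ e f e≢f → trans (edgeDist-identity e≢f) (split (ρ e f) (P e f))) ⟩
    pairSum m (λ e f → ρ e f + ρ e f + (ρ e f + ρ e f) + (P e f + P e f))
      ≡⟨ pairSum-+ m _ (λ e f → P e f + P e f) ⟩
    pairSum m (λ e f → ρ e f + ρ e f + (ρ e f + ρ e f)) + pairSum m (λ e f → P e f + P e f)
      ≡⟨ cong₂ _+_ (trans (pairSum-+ m (λ e f → ρ e f + ρ e f) _) (cong₂ _+_ (pairSum-+ m ρ ρ) (pairSum-+ m ρ ρ)))
                   (trans (pairSum-+ m P P) (cong₂ _+_ swapSums swapSums)) ⟩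
    edgeWiener G + edgeWiener G + (edgeWiener G + edgeWiener G) + (pairSum d crossings + pairSum d crossings) ∎
    where
    open ≡-Reasoning
    m = size G
    ρ P : Edge G → Edge G → ℕ
    ρ = edgeDist G
    P = doublySeparated
    split : ∀ x y → 4 * x + 2 * y ≡ x + x + (x + x) + (y + y)
    split = solve 2 (λ x y → con 4 :* x :+ con 2 :* y := x :+ x :+ (x :+ x) :+ (y :+ y)) refl
      where open +-*-Solver
    swapSums : pairSum m P ≡ pairSum d crossings
    swapSums = trans (pairSum-comm m d λ e f k l → separates k e f * separates l e f)
                     (pairSum-cong d λ k l _ → pairSum-crossings k l)

-- Passage to the rationals

/1-homo-+ : ∀ m n → + (m + n) / 1 ≡ (+ m / 1) ℚ.+ (+ n / 1)
-- `_/_` reduces fractions to lowest terms, so the computation takes place among unnormalised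
-- rationals.
/1-homo-+ m n = ℚ.toℚᵘ-injective $ begin
  toℚᵘ (+ (m + n) / 1)
    ≈⟨ ℚ.toℚᵘ-fromℚᵘ (mkℚᵘ (+ (m + n)) 0) ⟩
  mkℚᵘ (+ (m + n)) 0
    ≈⟨ *≡* (cong (ℤ._* + 1) (sym (cong₂ ℤ._+_ (ℤ.*-identityʳ (+ m)) (ℤ.*-identityʳ (+ n))))) ⟩
  mkℚᵘ (+ m) 0 ℚᵘ.+ mkℚᵘ (+ n) 0
    ≈⟨ ℚᵘ.+-cong (ℚ.toℚᵘ-fromℚᵘ (mkℚᵘ (+ m) 0)) (ℚ.toℚᵘ-fromℚᵘ (mkℚᵘ (+ n) 0)) ⟨
  toℚᵘ (+ m / 1) ℚᵘ.+ toℚᵘ (+ n / 1)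
    ≈⟨ ℚ.toℚᵘ-homo-+ (+ m / 1) (+ n / 1) ⟨
  toℚᵘ ((+ m / 1) ℚ.+ (+ n / 1)) ∎
  where open SetoidReasoning ℚᵘ.≃-setoid

-- Half of the doubled identity: adding `c` twice under the factor ½ pays for subtracting it once
-- outside.
halve : ∀ w s c p → w + s + (c + c) ≡ w + w + (w + w) + (p + p) →
  ½ ℚ.* (+ w / 1) ℚ.+ ½ ℚ.* (+ s / 1) ≡ (+ 2 / 1) ℚ.* (+ w / 1) ℚ.+ (+ p / 1) ℚ.- (+ c / 1)
halve w s c p eq = begin
  ½ ℚ.* w′ ℚ.+ ½ ℚ.* s′
    ≡⟨ solve 3 (λ w s c → con ½ :* w :+ con ½ :* s := con ½ :* (w :+ s :+ (c :+ c)) :- c) refl w′ s′ c′ ⟩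
  ½ ℚ.* (w′ ℚ.+ s′ ℚ.+ (c′ ℚ.+ c′)) ℚ.- c′
    ≡⟨ cong (λ x → ½ ℚ.* x ℚ.- c′) cast ⟩
  ½ ℚ.* (w′ ℚ.+ w′ ℚ.+ (w′ ℚ.+ w′) ℚ.+ (p′ ℚ.+ p′)) ℚ.- c′
    ≡⟨ solve 3 (λ w c p → con ½ :* (w :+ w :+ (w :+ w) :+ (p :+ p)) :- c := con (+ 2 / 1) :* w :+ p :- c) refl w′ c′ p′ ⟩
  (+ 2 / 1) ℚ.* w′ ℚ.+ p′ ℚ.- c′ ∎
  where
  open ≡-Reasoning
  open ℚ-Solver.+-*-Solver
  w′ = + w / 1
  s′ = + s / 1
  c′ = + c / 1
  p′ = + p / 1
  homo : ∀ {x y x′ y′} → + x / 1 ≡ x′ → + y / 1 ≡ y′ → + (x + y) / 1 ≡ x′ ℚ.+ y′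
  homo {x} {y} refl refl = /1-homo-+ x y
  cast : w′ ℚ.+ s′ ℚ.+ (c′ ℚ.+ c′) ≡ w′ ℚ.+ w′ ℚ.+ (w′ ℚ.+ w′) ℚ.+ (p′ ℚ.+ p′)
  cast = trans (sym (homo {w + s} {c + c} (homo {w} {s} refl refl) (homo {c} {c} refl refl))) $ trans
    (cong (λ x → + x / 1) eq)
    (homo {w + w + (w + w)} {p + p}
      (homo {w + w} {w + w} (homo {w} {w} refl refl) (homo {w} {w} refl refl)) (homo {p} {p} refl refl))

theorem3p4 :
    ∀ {n} (G : Graph (Fin n)) → Connected G → IsPartialCube G →
    ∀ {d} (E : Fin d → EdgeSet G) → AreΘClasses G E →
    (U U′ : Fin d → Subset n) → (∀ k → AreTheTwoComponents (G ─ E k) (U k) (U′ k)) →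
    let E[U]  = λ k → edgesWithin G (E k) (U k)
        E[U′] = λ k → edgesWithin G (E k) (U′ k)
        m¹¹ = λ k l → ∣ E[U] k ∩ E[U] l ∣
        m¹⁰ = λ k l → ∣ E[U] k ∩ E[U′] l ∣
        m⁰¹ = λ k l → ∣ E[U′] k ∩ E[U] l ∣
        m⁰⁰ = λ k l → ∣ E[U′] k ∩ E[U′] l ∣
    in edgeHyperWiener G
         ≡ (+ 2 / 1) ℚ.* (+ edgeWiener G / 1)
           ℚ.+ (+ pairSum d (λ k l → m¹¹ k l * m⁰⁰ k l + m¹⁰ k l * m⁰¹ k l) / 1)
           ℚ.- (+ (size G C 2) / 1)
theorem3p4 G _ partialCube {d} E classes U U′ components =
  halve (edgeWiener G) (pairSum (size G) λ e f → edgeDist G e f ^ 2) (size G C 2)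
    (pairSum d (crossings embedding classes components))
    (wiener-identity embedding classes components)
  where embedding = partialCube⇒embedding partialCube
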